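{- Each of the following families of games is forced and miserable but not pet: Rook on the set of all rectangles; King on the set of all rectangles; Rook on the set of all nonempty subpartitions of generalized staircases.
   Context: A partition is a finite weakly decreasing sequence $\lambda=[\lambda_1,\ldots,\lambda_r]$ of positive integers; $[\,]$ is the empty partition, and $\mathbb Y^+$ is the set of nonempty partitions. For $i,j\ge 0$, $\lambda[i,j]=[\lambda_{i+1}-j,\lambda_{i+2}-j,\ldots]$ with trailing nonpositive entries removed. For a moveset $M\subseteq \mathbb Z_{\ge0}^2\setminus\{(0,0)\}$ and $\lambda\in\mathbb Y^+$, the impartial chess game $(M,\lambda)$ starts at $\lambda$, and from a position $\mu\in\mathbb Y^+$ a player may move to $\mu[i,j]$ for any $(i,j)\in M$ with $\mu[i,j]\ne[\,]$. The positions of $(M,\lambda)$ are the partitions reachable from $\lambda$ by zero or more moves. A position is terminal if it has no moves. Movesets: King $\{(0,1),(1,0),(1,1)\}$; Rook $\{(k,0):k\ge1\}\cup\{(0,k):k\ge1\}$. Rectangles are the partitions $[c^r]$ ($c$ repeated $r$ times), $r,c\ge1$; the generalized staircase with parameters $r,c,k\ge1$ is $[(kc)^r,((k-1)c)^r,\ldots,c^r]$ (exponents denote repetition). A nonempty subpartition of a generalized staircase $\lambda$ is a partition $\lambda[i,j]\neq[\,]$ with $i,j\ge0$. The Sprague-Grundy value of a position $p$ is $\mathrm{mex}$ of the Sprague-Grundy values of the positions reachable in one move ($0$ if $p$ is terminal), where $\mathrm{mex}(S)$ is the least nonnegative integer not in $S$. The misère Grundy value is defined by the same mex recursion at non-terminal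 positions, but terminal positions have value $1$. A position with Sprague-Grundy value $t$ and misère Grundy value $\ell$ is called a $(t,\ell)$-position. A game is forced if each move from a $(0,1)$-position results in a $(1,0)$-position and each move from a $(1,0)$-position results in a $(0,1)$-position. A game is miserable if for every position $x$ one of the following holds: (i) $x$ is a $(0,1)$-position or a $(1,0)$-position; (ii) there is no move from $x$ to a $(0,1)$-position or a $(1,0)$-position; (iii) there are moves from $x$ to both a $(0,1)$-position and a $(1,0)$-position. A game is pet if it has only $(0,1)$-positions, $(1,0)$-positions, and $(k,k)$-positions with $k\ge2$. For a moveset $M$ and a set $P\subseteq\mathbb Y^+$, the family $(M,P)$ has one of these properties if $(M,\lambda)$ has it for every $\lambda\in P$, and it does not have the property if $(M,\lambda)$ fails it for at least one $\lambda\in P$. -}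

module Defs where

open import Level using (0ℓ)
open import Data.Empty.Irrelevant using (⊥-elim)
open import Data.List.Base
  using (List; []; _∷_; _++_; map; filter; drop; length; replicate; upTo; cartesianProduct; mapMaybe)
open import Data.List.Membership.Propositional using (_∈_)
open import Data.List.Membership.Propositional.Properties
  using (∈-map⁺; ∈-map⁻; ∈-upTo⁺; ∈-cartesianProduct⁺)
open import Data.List.Properties using (map-cong)
open import Data.List.Relation.Unary.All as All using (All; []; _∷_)
import Data.List.Relation.Unary.All.Properties as All
open import Data.List.Relation.Unary.Any using (here; there)
import Data.List.Relation.Unary.AllPairs.Properties as AllPairs
open import Data.List.Relation.Unary.Linked as Linked using (Linked)
import Data.List.Relation.Unary.Linked.Properties as Linked
open import Data.Maybe.Base using (Maybe; just; nothing)
open import Data.Nat.Base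
open import Data.Nat.Induction using (<-wellFounded)
open import Data.Nat.ListAction using (sum)
open import Data.Nat.Properties
open import Data.List.Membership.DecPropositional _≟_ using (_∈?_)
open import Data.Product using (∃; ∃₂; _×_; _,_; proj₁; proj₂)
open import Data.Sum using (_⊎_; inj₁; inj₂)
open import Function.Base using (flip)
import Induction.WellFounded as WF
import Relation.Binary.Construct.On as On
open import Relation.Binary.Construct.Closure.ReflexiveTransitive using (Star)
open import Relation.Binary.PropositionalEquality
open import Relation.Nullary using (¬_; Dec; yes; no; contradiction)
open import Relation.Unary using (Pred; Decidable)

-- The proof fields are irrelevant, so equality of partitions is equality of parts.

record Partition : Set where
  constructor mkPartition
  field
    parts       : List ℕ
    .decreasing : Linked _≥_ parts
    .positive   : All (0 <_) parts

open Partition public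

record 𝕐⁺ : Set where
  constructor mk𝕐⁺
  field
    partition : Partition
    .nonempty : parts partition ≢ []

open 𝕐⁺ public

-- Truncated subtraction sends exactly the nonpositive entries to 0, and in a
-- weakly decreasing list the zeros are trailing.

cut : ℕ → ℕ → List ℕ → List ℕ
cut i j ps = filter (0 <?_) (map (_∸ j) (drop i ps))

cut-decreasing : ∀ i j {ps} → Linked _≥_ ps → Linked _≥_ (cut i j ps)
cut-decreasing i j d =
  Linked.AllPairs⇒Linked
    (AllPairs.filter⁺ (0 <?_)
      (Linked.Linked⇒AllPairs (flip ≤-trans)
        (Linked.map⁺ (Linked.map (∸-monoˡ-≤ j)
          (Linked.AllPairs⇒Linked
            (AllPairs.drop⁺ i (Linked.Linked⇒AllPairs (flip ≤-trans) d)))))))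

infix 8 _⟦_,_⟧

_⟦_,_⟧ : Partition → ℕ → ℕ → Partition
mkPartition ps d _ ⟦ i , j ⟧ = mkPartition
  (cut i j ps)
  (cut-decreasing i j d)
  (All.all-filter (0 <?_) (map (_∸ j) (drop i ps)))

record Moveset : Set₁ where
  field
    Contains   : Pred (ℕ × ℕ) 0ℓ
    contains?  : Decidable Contains
    no-trivial : ¬ Contains (0 , 0)

open Moveset public

Move : Moveset → 𝕐⁺ → 𝕐⁺ → Set
Move M μ ν = ∃₂ λ i j → Contains M (i , j) × partition ν ≡ partition μ ⟦ i , j ⟧

Position : Moveset → 𝕐⁺ → 𝕐⁺ → Set
Position M = Star (Move M)

Terminal : Moveset → 𝕐⁺ → Set
Terminal M μ = ∀ ν → ¬ Move M μ ν

weight : List ℕ → ℕ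
weight ps = length ps + sum ps

private
  shave : ℕ → List ℕ → List ℕ
  shave j ps = filter (0 <?_) (map (_∸ j) ps)

  shave-≤ : ∀ j ps → weight (shave j ps) ≤ weight ps
  shave-≤ j [] = z≤n
  shave-≤ j (x ∷ ps) with x ∸ j in eq
  ... | zero  = ≤-trans (shave-≤ j ps)
                  (≤-trans (+-monoʳ-≤ (length ps) (m≤n+m (sum ps) x)) (n≤1+n _))
  ... | suc y = s≤s (begin
    length qs + (suc y + sum qs)   ≡⟨ x∙yz≈y∙xz (length qs) (suc y) (sum qs) ⟩
    suc y + weight qs              ≤⟨ +-mono-≤ y≤x (shave-≤ j ps) ⟩
    x + weight ps                  ≡⟨ x∙yz≈y∙xz x (length ps) (sum ps) ⟩
    length ps + (x + sum ps)       ∎)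
    where
    open ≤-Reasoning
    open import Algebra.Properties.CommutativeSemigroup +-commutativeSemigroup
      using (x∙yz≈y∙xz)
    qs = shave j ps
    y≤x : suc y ≤ x
    y≤x = subst (_≤ x) eq (m∸n≤m x j)

  shave-< : ∀ j {ps} → ps ≢ [] → weight (shave (suc j) ps) < weight ps
  shave-< j {[]} ne = contradiction refl ne
  shave-< j {x ∷ ps} _ with x ∸ suc j in eq
  ... | zero  = s≤s (≤-trans (shave-≤ (suc j) ps)
                       (+-monoʳ-≤ (length ps) (m≤n+m (sum ps) x)))
  ... | suc y = s≤s (begin-strict
    length qs + (suc y + sum qs)   ≡⟨ x∙yz≈y∙xz (length qs) (suc y) (sum qs) ⟩
    suc y + weight qs              <⟨ +-mono-<-≤ y<x (shave-≤ (suc j) ps) ⟩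
    x + weight ps                  ≡⟨ x∙yz≈y∙xz x (length ps) (sum ps) ⟩
    length ps + (x + sum ps)       ∎)
    where
    open ≤-Reasoning
    open import Algebra.Properties.CommutativeSemigroup +-commutativeSemigroup
      using (x∙yz≈y∙xz)
    qs = shave (suc j) ps
    y<x : suc y < x
    y<x = subst (_< x) eq (∸-decreasing x (λ { refl → contradiction eq λ () }))
      where
      ∸-decreasing : ∀ x → x ≢ 0 → x ∸ suc j < x
      ∸-decreasing zero    ne = contradiction refl ne
      ∸-decreasing (suc x) _  = s≤s (m∸n≤m x j)

  drop-≤ : ∀ i ps → weight (drop i ps) ≤ weight ps
  drop-≤ zero    ps       = ≤-refl
  drop-≤ (suc i) []       = z≤n
  drop-≤ (suc i) (x ∷ ps) = ≤-trans (drop-≤ i ps)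
    (≤-trans (+-monoʳ-≤ (length ps) (m≤n+m (sum ps) x)) (n≤1+n _))

  drop-< : ∀ i {ps} → ps ≢ [] → weight (drop (suc i) ps) < weight ps
  drop-< i {[]}     ne = contradiction refl ne
  drop-< i {x ∷ ps} _  = s≤s (≤-trans (drop-≤ i ps)
    (+-monoʳ-≤ (length ps) (m≤n+m (sum ps) x)))

  cut-< : ∀ M {i j ps} → Contains M (i , j) → ps ≢ [] → weight (cut i j ps) < weight ps
  cut-< M {zero}  {zero}  c _  = contradiction c (no-trivial M)
  cut-< M {zero}  {suc j} _ ne = shave-< j ne
  cut-< M {suc i} {j} {ps} _ ne = ≤-<-trans (shave-≤ j (drop (suc i) ps)) (drop-< i ne)

  ≢[] : ∀ μ → parts (partition μ) ≢ []
  ≢[] (mk𝕐⁺ _ ne) eq = ⊥-elim (ne eq)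

weight⁺ : 𝕐⁺ → ℕ
weight⁺ μ = weight (parts (partition μ))

move-< : ∀ M {μ ν} → Move M μ ν → weight⁺ ν < weight⁺ μ
move-< M {μ} (i , j , c , refl) = cut-< M c (≢[] μ)

move-wellFounded : ∀ M → WF.WellFounded (flip (Move M))
move-wellFounded M =
  WF.Subrelation.wellFounded (λ {ν} {μ} → move-< M {μ} {ν}) (On.wellFounded weight⁺ <-wellFounded)

private
  []? : (xs : List ℕ) → Dec (xs ≡ [])
  []? []      = yes refl
  []? (_ ∷ _) = no λ ()

  asMove : ∀ M μ → ℕ × ℕ → Maybe (∃ (Move M μ))
  asMove M μ (i , j) with contains? M (i , j) | []? (cut i j (parts (partition μ)))
  ... | yes c | no ne = just (mk𝕐⁺ (partition μ ⟦ i , j ⟧) ne , i , j , c , refl)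
  ... | yes _ | yes _ = nothing
  ... | no  _ | _     = nothing

-- Pairs (i , j) outside the listed range give μ[i,j] = [].

moves : ∀ M μ → List (∃ (Move M μ))
moves M μ = mapMaybe (asMove M μ) (cartesianProduct (upTo (length ps)) (upTo (sum ps)))
  where ps = parts (partition μ)

private
  cut-row : ∀ i j ps → cut i j ps ≢ [] → i < length ps
  cut-row zero    j []       ne = contradiction refl ne
  cut-row (suc i) j []       ne = contradiction refl ne
  cut-row zero    j (x ∷ ps) ne = z<s
  cut-row (suc i) j (x ∷ ps) ne = s<s (cut-row i j ps ne)

  shave-col : ∀ j ps → shave j ps ≢ [] → j < sum ps
  shave-col j [] ne = contradiction refl ne
  shave-col j (x ∷ ps) ne with x ∸ j in eq
  ... | zero  = <-≤-trans (shave-col j ps ne) (m≤n+m (sum ps) x)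
  ... | suc y = <-≤-trans (m∸n≢0⇒n<m {x} {j} λ e → contradiction (trans (sym eq) e) λ ())
                          (m≤m+n x (sum ps))

  cut-col : ∀ i j ps → cut i j ps ≢ [] → j < sum ps
  cut-col zero    j ps       ne = shave-col j ps ne
  cut-col (suc i) j []       ne = contradiction refl ne
  cut-col (suc i) j (x ∷ ps) ne = <-≤-trans (cut-col i j ps ne) (m≤n+m (sum ps) x)

  ∈-mapMaybe : ∀ {A B : Set} (f : A → Maybe B) {x y xs} →
               x ∈ xs → f x ≡ just y → y ∈ mapMaybe f xs
  ∈-mapMaybe f {x} (here refl) eq rewrite eq = here refl
  ∈-mapMaybe f {xs = z ∷ _} (there p) eq with f z
  ... | nothing = ∈-mapMaybe f p eq
  ... | just _  = there (∈-mapMaybe f p eq)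

  asMove-complete : ∀ M μ {ν i j} → Contains M (i , j) → partition ν ≡ partition μ ⟦ i , j ⟧ →
                    ∃ λ m → asMove M μ (i , j) ≡ just (ν , m)
  asMove-complete M μ {ν} {i} {j} c refl
    with contains? M (i , j) | []? (cut i j (parts (partition μ)))
  ... | yes _ | no _  = _ , refl
  ... | yes _ | yes e = contradiction e (≢[] ν)
  ... | no ¬c | _     = contradiction c ¬c

moves-complete : ∀ M {μ ν} → Move M μ ν → ∃ λ m → (ν , m) ∈ moves M μ
moves-complete M {μ} {ν} (i , j , c , refl)
  with m , eq ← asMove-complete M μ {ν} c refl =
  m , ∈-mapMaybe (asMove M μ)
        (∈-cartesianProduct⁺ (∈-upTo⁺ (cut-row i j _ ne)) (∈-upTo⁺ (cut-col i j _ ne)))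
        eq
  where
  ne : cut i j (parts (partition μ)) ≢ []
  ne = ≢[] ν

IsMex : Pred ℕ 0ℓ → Pred ℕ 0ℓ
IsMex S n = ¬ S n × (∀ {m} → m < n → S m)

private
  mex-search : ∀ xs f n → All (_< f + n) xs → (∀ {m} → m < n → m ∈ xs) → ∃ (IsMex (_∈ xs))
  mex-search xs zero    n b below = n , (λ n∈ → n≮n _ (All.lookup b n∈)) , below
  mex-search xs (suc f) n b below with n ∈? xs
  ... | no  n∉ = n , n∉ , below
  ... | yes n∈ = mex-search xs f (suc n) (All.map (λ {m} → subst (m <_) (sym (+-suc f n))) b) below′
    where
    below′ : ∀ {m} → m < suc n → m ∈ xs
    below′ m<1+n with m≤n⇒m<n∨m≡n (s≤s⁻¹ m<1+n)
    ... | inj₁ m<n  = below m<n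
    ... | inj₂ refl = n∈

  ≤-sum : ∀ xs → All (_≤ sum xs) xs
  ≤-sum []       = []
  ≤-sum (x ∷ xs) = m≤m+n x _ ∷ All.map (λ p → ≤-trans p (m≤n+m _ x)) (≤-sum xs)

mex-exists : ∀ xs → ∃ (IsMex (_∈ xs))
mex-exists xs = mex-search xs (suc (sum xs)) 0
  (All.map (λ p → s≤s (≤-trans p (≤-reflexive (sym (+-identityʳ _))))) (≤-sum xs)) λ ()

mex : List ℕ → ℕ
mex xs = proj₁ (mex-exists xs)

-- The argument e is the value given to terminal positions.

mexOr : ℕ → List ℕ → ℕ
mexOr e []         = e
mexOr e xs@(_ ∷ _) = mex xs

private
  step : ∀ M (e : ℕ) μ → (∀ {ν} → Move M μ ν → ℕ) → ℕ
  step M e μ rec = mexOr e (map (λ (ν , m) → rec {ν} m) (moves M μ))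

-- Opaque to keep goals small; value-terminal and value-mex below give the
-- defining recursion.

opaque
  value : Moveset → ℕ → 𝕐⁺ → ℕ
  value M e = WF.All.wfRec (move-wellFounded M) 0ℓ (λ _ → ℕ) (step M e)

  value-unfold : ∀ M e μ → value M e μ ≡ mexOr e (map (λ (ν , _) → value M e ν) (moves M μ))
  value-unfold M e μ = WF.FixPoint.unfold-wfRec (move-wellFounded M) (λ _ → ℕ) (step M e)
    (λ x eq → cong (mexOr e) (map-cong (λ (ν , m) → eq {ν} m) (moves M x))) {μ}

grundy misère : Moveset → 𝕐⁺ → ℕ
grundy M = value M 0
misère M = value M 1

value-terminal : ∀ M e {μ} → Terminal M μ → value M e μ ≡ e
value-terminal M e {μ} t = trans (value-unfold M e μ) (go (moves M μ))
  where
  go : ∀ ms → mexOr e (map (λ (ν , _) → value M e ν) ms) ≡ e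
  go []            = refl
  go ((ν , m) ∷ _) = contradiction m (t ν)

value-mex : ∀ M e {μ} → ¬ Terminal M μ →
            IsMex (λ n → ∃ λ ν → Move M μ ν × value M e ν ≡ n) (value M e μ)
value-mex M e {μ} ¬t =
  subst (IsMex Attained) (sym (value-unfold M e μ))
    (go (moves M μ) (λ ν m → moves-complete M {μ} {ν} m))
  where
  Attained : Pred ℕ 0ℓ
  Attained n = ∃ λ ν → Move M μ ν × value M e ν ≡ n
  val : ∃ (Move M μ) → ℕ
  val (ν , _) = value M e ν
  go : ∀ ms → (∀ ν → Move M μ ν → ∃ λ m → (ν , m) ∈ ms) → IsMex Attained (mexOr e (map val ms))
  go [] complete = contradiction (λ ν m → case-[] (proj₂ (complete ν m))) ¬t
    where
    case-[] : ∀ {x : ∃ (Move M μ)} → ¬ (x ∈ [])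
    case-[] ()
  go ms@(_ ∷ _) complete = not-attained , attained
    where
    spec : IsMex (_∈ map val ms) (mex (map val ms))
    spec = proj₂ (mex-exists (map val ms))
    not-attained : ¬ Attained (mex (map val ms))
    not-attained (ν , m , v) with m′ , p ← complete ν m =
      proj₁ spec (subst (_∈ map val ms) v (∈-map⁺ val {x = ν , m′} p))
    attained : ∀ {n} → n < mex (map val ms) → Attained n
    attained n< with (ν , m) , _ , v ← ∈-map⁻ val {xs = ms} (proj₂ spec n<) = ν , m , sym v

_⊢_isA⟨_,_⟩ : Moveset → 𝕐⁺ → ℕ → ℕ → Set
M ⊢ x isA⟨ t , ℓ ⟩ = grundy M x ≡ t × misère M x ≡ ℓ

Game : Set₁
Game = Moveset × 𝕐⁺

Forced : Pred Game 0ℓ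
Forced (M , μ) = ∀ {x y} → Position M μ x → Move M x y →
  (M ⊢ x isA⟨ 0 , 1 ⟩ → M ⊢ y isA⟨ 1 , 0 ⟩) ×
  (M ⊢ x isA⟨ 1 , 0 ⟩ → M ⊢ y isA⟨ 0 , 1 ⟩)

MoveTo : Moveset → 𝕐⁺ → ℕ → ℕ → Set
MoveTo M x t ℓ = ∃ λ y → Move M x y × M ⊢ y isA⟨ t , ℓ ⟩

Miserable : Pred Game 0ℓ
Miserable (M , μ) = ∀ {x} → Position M μ x →
  (M ⊢ x isA⟨ 0 , 1 ⟩ ⊎ M ⊢ x isA⟨ 1 , 0 ⟩) ⊎
  ¬ (MoveTo M x 0 1 ⊎ MoveTo M x 1 0) ⊎
  (MoveTo M x 0 1 × MoveTo M x 1 0)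

Pet : Pred Game 0ℓ
Pet (M , μ) = ∀ {x} → Position M μ x →
  M ⊢ x isA⟨ 0 , 1 ⟩ ⊎
  M ⊢ x isA⟨ 1 , 0 ⟩ ⊎
  ∃ λ k → 2 ≤ k × M ⊢ x isA⟨ k , k ⟩

FamilyHas : Pred Game 0ℓ → Moveset → Pred 𝕐⁺ 0ℓ → Set
FamilyHas Q M P = ∀ μ → P μ → Q (M , μ)

FamilyLacks : Pred Game 0ℓ → Moveset → Pred 𝕐⁺ 0ℓ → Set
FamilyLacks Q M P = ∃ λ μ → P μ × ¬ Q (M , μ)

data KingMove : Pred (ℕ × ℕ) 0ℓ where
  01∈ : KingMove (0 , 1)
  10∈ : KingMove (1 , 0)
  11∈ : KingMove (1 , 1)

data RookMove : Pred (ℕ × ℕ) 0ℓ where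
  k0∈ : ∀ {k} → 1 ≤ k → RookMove (k , 0)
  0k∈ : ∀ {k} → 1 ≤ k → RookMove (0 , k)

King : Moveset
King = record
  { Contains   = KingMove
  ; contains?  = dec
  ; no-trivial = λ ()
  }
  where
  dec : Decidable KingMove
  dec (0 , 0)             = no λ ()
  dec (0 , 1)             = yes 01∈
  dec (0 , suc (suc _))   = no λ ()
  dec (1 , 0)             = yes 10∈
  dec (1 , 1)             = yes 11∈
  dec (1 , suc (suc _))   = no λ ()
  dec (suc (suc _) , _)   = no λ ()

Rook : Moveset
Rook = record
  { Contains   = RookMove
  ; contains?  = dec
  ; no-trivial = λ { (k0∈ ()) ; (0k∈ ()) }
  }
  where
  dec : Decidable RookMove
  dec (0 , 0)         = no λ { (k0∈ ()) ; (0k∈ ()) }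
  dec (0 , suc _)     = yes (0k∈ z<s)
  dec (suc _ , 0)     = yes (k0∈ z<s)
  dec (suc _ , suc _) = no λ ()

Rectangle : Pred 𝕐⁺ 0ℓ
Rectangle μ = ∃₂ λ r c → 1 ≤ r × 1 ≤ c × parts (partition μ) ≡ replicate r c

staircase : ℕ → ℕ → ℕ → List ℕ
staircase r c zero    = []
staircase r c (suc k) = replicate r (suc k * c) ++ staircase r c k

GeneralizedStaircase : Pred 𝕐⁺ 0ℓ
GeneralizedStaircase μ = ∃₂ λ r c → ∃ λ k →
  1 ≤ r × 1 ≤ c × 1 ≤ k × parts (partition μ) ≡ staircase r c k

-- Nonemptiness of the subpartition is carried by its type 𝕐⁺.

StaircaseSubpartition : Pred 𝕐⁺ 0ℓ
StaircaseSubpartition μ = ∃ λ σ → GeneralizedStaircase σ ×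
  ∃₂ λ i j → partition μ ≡ partition σ ⟦ i , j ⟧

ForcedMiserableNotPet : Moveset → Pred 𝕐⁺ 0ℓ → Set
ForcedMiserableNotPet M P =
  FamilyHas Forced M P × FamilyHas Miserable M P × FamilyLacks Pet M P

module Submission where

open import Defs

open import Data.Empty.Irrelevant using (⊥-elim)
open import Data.List.Base using (List; []; _∷_; _++_; drop; replicate)
open import Data.List.Properties using (++-identityʳ; drop-[])
open import Data.List.Relation.Unary.All using ([]; _∷_)
open import Data.List.Relation.Unary.Linked using ([-]; _∷_)
open import Data.Nat.Base
open import Data.Nat.Properties
open import Data.Product using (∃; ∃₂; _×_; _,_; proj₁; proj₂)
open import Data.Sum as Sum using (_⊎_; inj₁; inj₂)
open import Function.Base using (flip; id)
open import Induction.WellFounded using (Acc; acc)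
open import Level using (0ℓ)
open import Relation.Binary.Construct.Closure.ReflexiveTransitive using (ε; _◅_)
open import Relation.Binary.PropositionalEquality
open import Relation.Nullary using (¬_; contradiction)
open import Relation.Unary using (Pred)

-- Call a position small if it is a (0,1)- or a (1,0)-position.  Suppose the
-- positions of a game are labelled Zero, One or Other so that moves alternate
-- between Zero and One, and an Other position either has moves to both Zero and
-- One or has moves to Other only.  Then by induction the Zero positions are
-- (0,1), the One positions are (1,0), and an Other position has the same option
-- values in normal and misère play, so it is a (k,k)-position.
--
-- A subpartition of a staircase with r × c blocks is given by the box (of the
-- staircase) in its upper left corner, that is by the distance d of the block of
-- this box from the diagonal and the distances p, q of the box from the bottom and
-- the right side of its block.  The small positions of Rook are those with
-- d = 0 and p, q ≤ 1, except that for r = c = 1 they are those with d ≤ 1.  For King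
-- on rectangles they are the rectangles with one row or one column.

-- Mex values computed from the options.

≢[] : ∀ μ → parts (partition μ) ≢ []
≢[] (mk𝕐⁺ _ ne) eq = ⊥-elim (ne eq)

partition-≡ : ∀ {π ρ} → parts π ≡ parts ρ → π ≡ ρ
partition-≡ refl = refl

IsMex-unique : ∀ {S T : Pred ℕ 0ℓ} {m n} → (∀ {k} → S k → T k) → (∀ {k} → T k → S k) →
               IsMex S m → IsMex T n → m ≡ n
IsMex-unique S⊆T T⊆S (m∉ , m↓) (n∉ , n↓) =
  ≤-antisym (≮⇒≥ λ n<m → n∉ (S⊆T (m↓ n<m))) (≮⇒≥ λ m<n → m∉ (T⊆S (n↓ m<n)))

-- Terminality quantifies over all partitions, but the finite enumeration `moves` decides it. A
-- position labelled Zero may be of either kind, so its values are found by this case distinction.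
terminal-or-move : ∀ M μ → Terminal M μ ⊎ ∃ (Move M μ)
terminal-or-move M μ with moves M μ in eq
... | move ∷ _ = inj₂ move
... | []       = inj₁ λ ν m → let m′ , p = moves-complete M {μ} {ν} m in
                               case-[] {ν , m′} (subst ((ν , m′) ∈_) eq p)
  where
  open import Data.List.Membership.Propositional using (_∈_)
  case-[] : ∀ {x : ∃ (Move M μ)} → ¬ (x ∈ [])
  case-[] ()

module _ (M : Moveset) (e : ℕ) {μ : 𝕐⁺} where

  value-mex-move : ∃ (Move M μ) → IsMex (λ n → ∃ λ ν → Move M μ ν × value M e ν ≡ n) (value M e μ)
  value-mex-move (ν , m) = value-mex M e λ t → t ν m

  options-0⇒1 : ∃ (Move M μ) → (∀ {ν} → Move M μ ν → value M e ν ≡ 0) → value M e μ ≡ 1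
  options-0⇒1 (ν , m) all0 = IsMex-unique id id (value-mex-move (ν , m))
    ( (λ (ξ , m′ , v) → contradiction (trans (sym (all0 {ξ} m′)) v) λ ())
    , λ { z<s → ν , m , all0 {ν} m })

  options-1⇒0 : ∃ (Move M μ) → (∀ {ν} → Move M μ ν → value M e ν ≡ 1) → value M e μ ≡ 0
  options-1⇒0 mv all1 = IsMex-unique id id (value-mex-move mv)
    ((λ (ξ , m′ , v) → contradiction (trans (sym (all1 {ξ} m′)) v) λ ()) , λ ())

-- Models of a game by states, and their labellings.

record Model (M : Moveset) : Set₁ where
  field
    State    : Set
    _⟶_     : State → State → Set
    shape    : State → List ℕ
    shape-≢[] : ∀ s → shape s ≢ []
    sound    : ∀ s {i j} → Contains M (i , j) → cut i j (shape s) ≢ [] →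
               ∃ λ t → s ⟶ t × cut i j (shape s) ≡ shape t
    complete : ∀ {s t} → s ⟶ t → ∃₂ λ i j → Contains M (i , j) × cut i j (shape s) ≡ shape t

  -- The two lemmas that follow make this relation a bisimulation between the partition game and the
  -- states, so that labels, which speak of states only, yield values of positions.
  Depicts : State → Pred 𝕐⁺ 0ℓ
  Depicts s μ = parts (partition μ) ≡ shape s

  depict-option : ∀ {s μ ν} → Depicts s μ → Move M μ ν → ∃ λ t → s ⟶ t × Depicts t ν
  depict-option {s} {μ} {ν} refl (i , j , c , refl) = sound s c (≢[] ν)

  realise-option : ∀ {s t μ} → Depicts s μ → s ⟶ t → ∃ λ ν → Move M μ ν × Depicts t ν
  realise-option {s} {t} {μ} refl st with i , j , c , eq ← complete st =
    mk𝕐⁺ (partition μ ⟦ i , j ⟧) (λ e → shape-≢[] t (trans (sym eq) e)) , (i , j , c , refl) , eq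

module _ {State : Set} (_⟶_ : State → State → Set) where

  Branching : Pred State 0ℓ → Pred State 0ℓ → Pred State 0ℓ
  Branching Zero One s = (∃ λ t → s ⟶ t × Zero t) × (∃ λ t → s ⟶ t × One t)

  Remote : Pred State 0ℓ → Pred State 0ℓ
  Remote Other s = ∃ (s ⟶_) × (∀ {t} → s ⟶ t → Other t)

-- The labels need not cover all states; it suffices that options of labelled states are labelled. A
-- One state is required to have an option because a terminal position has values (0,1), not (1,0).
record Labelling {M : Moveset} (G : Model M) : Set₁ where
  open Model G

  field
    Zero One Other : Pred State 0ℓ

  Label : Pred State 0ℓ
  Label s = Zero s ⊎ One s ⊎ Other s

  field
    zero-option  : ∀ {s t} → Zero s → s ⟶ t → One t
    one-option   : ∀ {s t} → One s → s ⟶ t → Zero t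
    one-moves    : ∀ {s} → One s → ∃ (s ⟶_)
    other-option : ∀ {s t} → Other s → s ⟶ t → Label t
    other-split  : ∀ {s} → Other s → Branching _⟶_ Zero One s ⊎ Remote _⟶_ Other s

  Zero⇒01 One⇒10 Other⇒kk : State → 𝕐⁺ → Set
  Zero⇒01  s μ = Zero s → M ⊢ μ isA⟨ 0 , 1 ⟩
  One⇒10   s μ = One s → M ⊢ μ isA⟨ 1 , 0 ⟩
  Other⇒kk s μ = Other s → grundy M μ ≡ misère M μ

  private
    -- The three claims go through one induction because options carry other labels than the state
    -- itself. The induction runs along moves of partitions, which are known to be well-founded, and
    -- lets the depicting state vary.
    values : ∀ {s μ} → Acc (flip (Move M)) μ → Depicts s μ →
             Zero⇒01 s μ × One⇒10 s μ × Other⇒kk s μ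
    values {s} {μ} (acc rec) D = zeroV , oneV , otherV
      where
      ih : ∀ {t ν} → Move M μ ν → Depicts t ν → Zero⇒01 t ν × One⇒10 t ν × Other⇒kk t ν
      ih {ν = ν} m = values (rec {ν} m)

      zeroV : Zero⇒01 s μ
      zeroV z with terminal-or-move M μ
      ... | inj₁ t  = value-terminal M 0 t , value-terminal M 1 t
      ... | inj₂ mv = options-1⇒0 M 0 mv (λ {ν} m → proj₁ (opt {ν} m))
                    , options-0⇒1 M 1 mv (λ {ν} m → proj₂ (opt {ν} m))
        where
        opt : ∀ {ν} → Move M μ ν → M ⊢ ν isA⟨ 1 , 0 ⟩
        opt {ν} m with t , st , D′ ← depict-option {μ = μ} {ν} D m =
          proj₁ (proj₂ (ih {ν = ν} m D′)) (zero-option z st)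

      oneV : One⇒10 s μ
      oneV o with ν , m , _ ← realise-option {μ = μ} D (proj₂ (one-moves o)) =
          options-0⇒1 M 0 (ν , m) (λ {ν} m → proj₁ (opt {ν} m))
        , options-1⇒0 M 1 (ν , m) (λ {ν} m → proj₂ (opt {ν} m))
        where
        opt : ∀ {ν} → Move M μ ν → M ⊢ ν isA⟨ 0 , 1 ⟩
        opt {ν} m with t , st , D′ ← depict-option {μ = μ} {ν} D m =
          proj₁ (ih {ν = ν} m D′) (one-option o st)

      Attained : ℕ → Pred ℕ 0ℓ
      Attained e n = ∃ λ ν → Move M μ ν × value M e ν ≡ n

      otherV : Other⇒kk s μ
      otherV x with other-split x
      ... | inj₂ ((t , st) , rem) with ν , m , _ ← realise-option {μ = μ} D st =
        IsMex-unique
          (λ (ν , m , v) → ν , m , trans (sym (same {ν} m)) v)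
          (λ (ν , m , v) → ν , m , trans (same {ν} m) v)
          (value-mex-move M 0 (ν , m)) (value-mex-move M 1 (ν , m))
        where
        same : ∀ {ν} → Move M μ ν → grundy M ν ≡ misère M ν
        same {ν} m with t , st , D′ ← depict-option {μ = μ} {ν} D m =
          proj₂ (proj₂ (ih {ν = ν} m D′)) (rem st)
      ... | inj₁ ((t₀ , st₀ , z) , (t₁ , st₁ , o))
        with ν₀ , m₀ , D₀ ← realise-option {μ = μ} D st₀
           | ν₁ , m₁ , D₁ ← realise-option {μ = μ} D st₁
        with g₀ , l₀ ← proj₁ (ih {ν = ν₀} m₀ D₀) z
           | g₁ , l₁ ← proj₁ (proj₂ (ih {ν = ν₁} m₁ D₁)) o =
        IsMex-unique to from (value-mex-move M 0 (ν₀ , m₀)) (value-mex-move M 1 (ν₀ , m₀))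
        where
        option-values : ∀ {ν} → Move M μ ν →
          M ⊢ ν isA⟨ 0 , 1 ⟩ ⊎ M ⊢ ν isA⟨ 1 , 0 ⟩ ⊎ grundy M ν ≡ misère M ν
        option-values {ν} m with t , st , D′ ← depict-option {μ = μ} {ν} D m
          with ihZ , ihO , ihX ← ih {ν = ν} m D′ =
          Sum.map ihZ (Sum.map ihO ihX) (other-option x st)
        -- Passing between normal and misère play swaps the values 0 and 1 of small options. As both
        -- branches are present, the value lost at one is regained at the other.
        to : ∀ {n} → Attained 0 n → Attained 1 n
        to (ν , m , v) with option-values {ν} m
        ... | inj₁ (g , _)        = ν₁ , m₁ , trans l₁ (trans (sym g) v)
        ... | inj₂ (inj₁ (g , _)) = ν₀ , m₀ , trans l₀ (trans (sym g) v)
        ... | inj₂ (inj₂ same)    = ν , m , trans (sym same) v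
        from : ∀ {n} → Attained 1 n → Attained 0 n
        from (ν , m , v) with option-values {ν} m
        ... | inj₁ (_ , l)        = ν₁ , m₁ , trans g₁ (trans (sym l) v)
        ... | inj₂ (inj₁ (_ , l)) = ν₀ , m₀ , trans g₀ (trans (sym l) v)
        ... | inj₂ (inj₂ same)    = ν , m , trans same v

  module _ {s μ} (D : Depicts s μ) where

    zero-value : Zero⇒01 s μ
    zero-value = proj₁ (values (move-wellFounded M μ) D)

    one-value : One⇒10 s μ
    one-value = proj₁ (proj₂ (values (move-wellFounded M μ) D))

    other-value : Other⇒kk s μ
    other-value = proj₂ (proj₂ (values (move-wellFounded M μ) D))

    other-not-01 : Other s → ¬ M ⊢ μ isA⟨ 0 , 1 ⟩
    other-not-01 x (g , l) = contradiction (trans (sym g) (trans (other-value x) l)) λ ()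

    other-not-10 : Other s → ¬ M ⊢ μ isA⟨ 1 , 0 ⟩
    other-not-10 x (g , l) = contradiction (trans (sym g) (trans (other-value x) l)) λ ()

  label-option : ∀ {s t} → Label s → s ⟶ t → Label t
  label-option (inj₁ z)        st = inj₂ (inj₁ (zero-option z st))
  label-option (inj₂ (inj₁ o)) st = inj₁ (one-option o st)
  label-option (inj₂ (inj₂ x)) st = other-option x st

  label-position : ∀ {s μ x} → Label s → Depicts s μ → Position M μ x →
                   ∃ λ t → Label t × Depicts t x
  label-position L D ε = _ , L , D
  label-position {μ = μ} L D (_◅_ {j = ν} m ms)
    with t , st , D′ ← depict-option {μ = μ} {ν} D m =
    label-position (label-option L st) D′ ms

  -- The values of a small position reveal its label: Zero and One differ in their Grundy value, and
  -- on Other the two values agree. The options then have the opposite label.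
  forced : ∀ {s μ} → Label s → Depicts s μ → Forced (M , μ)
  forced L D {x} {y} pos m with s , L′ , D′ ← label-position L D pos
    with t , st , D″ ← depict-option {μ = x} {y} D′ m with L′
  ... | inj₁ z = (λ _ → one-value D″ (zero-option z st))
               , λ (g , _) → contradiction (trans (sym (proj₁ (zero-value D′ z))) g) λ ()
  ... | inj₂ (inj₁ o) = (λ (g , _) → contradiction (trans (sym (proj₁ (one-value D′ o))) g) λ ())
                      , λ _ → zero-value D″ (one-option o st)
  ... | inj₂ (inj₂ o) = (λ v → contradiction v (other-not-01 D′ o))
                      , (λ v → contradiction v (other-not-10 D′ o))

  miserable : ∀ {s μ} → Label s → Depicts s μ → Miserable (M , μ)
  miserable L D {x} pos with s , L′ , D′ ← label-position L D pos with L′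
  ... | inj₁ z        = inj₁ (inj₁ (zero-value D′ z))
  ... | inj₂ (inj₁ o) = inj₁ (inj₂ (one-value D′ o))
  ... | inj₂ (inj₂ u) with other-split u
  ... | inj₁ ((t₀ , st₀ , z) , (t₁ , st₁ , o))
    with ν₀ , m₀ , D₀ ← realise-option {μ = x} D′ st₀
       | ν₁ , m₁ , D₁ ← realise-option {μ = x} D′ st₁ =
    inj₂ (inj₂ ((ν₀ , m₀ , zero-value D₀ z) , (ν₁ , m₁ , one-value D₁ o)))
  ... | inj₂ (_ , rem) = inj₂ (inj₁ λ
    { (inj₁ (y , m , v)) → let t , st , D″ = depict-option {μ = x} {y} D′ m in
                           other-not-01 D″ (rem st) v
    ; (inj₂ (y , m , v)) → let t , st , D″ = depict-option {μ = x} {y} D′ m in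
                           other-not-10 D″ (rem st) v })

  -- A (k,k)-position with k ≥ 2 has an option of Sprague-Grundy value 0, and in a
  -- pet game this option would be a (0,1)-position.
  not-pet : ∀ {s μ} → Other s → Remote _⟶_ Other s → Depicts s μ → ¬ Pet (M , μ)
  not-pet {s} {μ} x ((t , st) , rem) D pet with pet ε
  ... | inj₁ v        = other-not-01 D x v
  ... | inj₂ (inj₁ v) = other-not-10 D x v
  ... | inj₂ (inj₂ (k , 2≤k , g , _))
    with ν , m , _ ← realise-option {μ = μ} D st
    with y , m′ , v ← proj₂ (value-mex-move M 0 (ν , m)) (subst (0 <_) (sym g) (<-trans z<s 2≤k))
    with t′ , st′ , D′ ← depict-option {μ = μ} {y} D m′
    with pet {y} (m′ ◅ ε)
  ... | inj₁ w                       = other-not-01 D′ (rem st′) w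
  ... | inj₂ (inj₁ w)                = other-not-10 D′ (rem st′) w
  ... | inj₂ (inj₂ (l , 2≤l , h , _)) =
    contradiction (subst (2 ≤_) (trans (sym h) v) 2≤l) λ ()

-- Counting lines down through successive blocks.

-- Lexicographic order on the pairs (d , p) with p ≤ n, where the bound is imposed
-- only when d decreases.
data Below (n : ℕ) : ℕ × ℕ → ℕ × ℕ → Set where
  inner : ∀ {d p p′} → p′ < p → Below n (d , p′) (d , p)
  outer : ∀ {d d′ p p′} → d′ < d → p′ ≤ n → Below n (d′ , p′) (d , p)

-- Applied to rows and to columns: op a removes a lines from f d p, which has p lines
-- left below the first one in its block and d further blocks of suc n lines.
module Countdown
  (n : ℕ) (f : ℕ → ℕ → List ℕ) (op : ℕ → List ℕ → List ℕ)
  (op-zero  : ∀ d p → op 0 (f d p) ≡ f d p)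
  (op-inner : ∀ a d p → op (suc a) (f d (suc p)) ≡ op a (f d p))
  (op-outer : ∀ a d → op (suc a) (f (suc d) 0) ≡ op a (f d n))
  (op-end   : ∀ a → op (suc a) (f 0 0) ≡ [])
  where

  -- The first removed line lowers p by one, or, when p is 0, leads to the full count n of the next
  -- block. Either step descends in `Below`, and induction on `a` handles the remaining lines.
  below : ∀ a d p → op (suc a) (f d p) ≢ [] →
          ∃₂ λ d′ p′ → Below n (d′ , p′) (d , p) × op (suc a) (f d p) ≡ f d′ p′
  below a zero zero ne = contradiction (op-end a) ne
  below zero d (suc p) ne = d , p , inner ≤-refl , trans (op-inner 0 d p) (op-zero d p)
  below zero (suc d) zero ne = d , n , outer ≤-refl ≤-refl , trans (op-outer 0 d) (op-zero d n)
  below (suc a) d (suc p) ne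
    with below a d p (λ e → ne (trans (op-inner (suc a) d p) e))
  ... | _ , _ , inner l , eq   = _ , _ , inner (m<n⇒m<1+n l) , trans (op-inner (suc a) d p) eq
  ... | _ , _ , outer l b , eq = _ , _ , outer l b , trans (op-inner (suc a) d p) eq
  below (suc a) (suc d) zero ne
    with below a d n (λ e → ne (trans (op-outer (suc a) d) e))
  ... | _ , _ , inner l , eq   = _ , _ , outer ≤-refl (<⇒≤ l) , trans (op-outer (suc a) d) eq
  ... | _ , _ , outer l b , eq = _ , _ , outer (m<n⇒m<1+n l) b , trans (op-outer (suc a) d) eq

  -- Removing lines one at a time visits every smaller pair within the bound, so none is skipped.
  attained : ∀ d p {d′ p′} → Below n (d′ , p′) (d , p) → ∃ λ a → op (suc a) (f d p) ≡ f d′ p′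
  attained d (suc p) (inner l) with m≤n⇒m<n∨m≡n (s≤s⁻¹ l)
  ... | inj₂ refl = 0 , trans (op-inner 0 d p) (op-zero d p)
  ... | inj₁ l′ with a , eq ← attained d p (inner l′) = suc a , trans (op-inner (suc a) d p) eq
  attained d (suc p) (outer l b) with a , eq ← attained d p (outer l b) =
    suc a , trans (op-inner (suc a) d p) eq
  -- One removal leads to (d , n). The target lies in a later block, further down in this one, or is
  -- this very pair.
  attained (suc d) zero (outer l b) with m≤n⇒m<n∨m≡n (s≤s⁻¹ l) | m≤n⇒m<n∨m≡n b
  ... | inj₁ l′ | _ with a , eq ← attained d n (outer l′ b) =
    suc a , trans (op-outer (suc a) d) eq
  attained (suc d) zero _ | inj₂ refl | inj₁ b′ with a , eq ← attained d n (inner b′) =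
    suc a , trans (op-outer (suc a) d) eq
  attained (suc d) zero _ | inj₂ refl | inj₂ refl = 0 , trans (op-outer 0 d) (op-zero d n)

-- Removing columns, and the shapes of staircase subpartitions.

cut-suc : ∀ j ps → cut 0 (suc j) ps ≡ cut 0 j (cut 0 1 ps)
cut-suc j []                 = refl
cut-suc zero    (zero ∷ ps)  = cut-suc 0 ps
cut-suc (suc j) (zero ∷ ps)  = cut-suc (suc j) ps
cut-suc zero    (suc zero ∷ ps) = cut-suc 0 ps
cut-suc (suc j) (suc zero ∷ ps) = cut-suc (suc j) ps
cut-suc j       (suc (suc x) ∷ ps) with x | j
... | y | zero   = cong (suc y ∷_) (cut-suc 0 ps)
... | y | suc j′ with y ∸ j′
... | zero   = cut-suc (suc j′) ps
... | suc y′ = cong (suc y′ ∷_) (cut-suc (suc j′) ps)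

cut-replicate-0 : ∀ n x ys → cut 0 0 (replicate n (suc x) ++ ys) ≡ replicate n (suc x) ++ cut 0 0 ys
cut-replicate-0 zero    x ys = refl
cut-replicate-0 (suc n) x ys = cong (suc x ∷_) (cut-replicate-0 n x ys)

cut-replicate-1 : ∀ n x ys →
  cut 0 1 (replicate n (suc (suc x)) ++ ys) ≡ replicate n (suc x) ++ cut 0 1 ys
cut-replicate-1 zero    x ys = refl
cut-replicate-1 (suc n) x ys = cong (suc x ∷_) (cut-replicate-1 n x ys)

cut-ones : ∀ n → cut 0 1 (replicate n 1 ++ []) ≡ []
cut-ones zero    = refl
cut-ones (suc n) = cut-ones n

-- The blocks have suc r rows and suc c columns.
module Shape (r c : ℕ) where

  -- The `d` complete blocks of rows below the one that contains the corner. Counts are off by one: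
  -- `p` and `q` exclude the first row and column, which makes every `shape` nonempty, and
  -- `shape k r c` unfolds to `tail (suc k) c`, the whole staircase with k + 1 steps.
  tail : ℕ → ℕ → List ℕ
  tail zero    q = []
  tail (suc d) q = replicate (suc r) (suc (q + d * suc c)) ++ tail d q

  shape : ℕ → ℕ → ℕ → List ℕ
  shape d p q = replicate (suc p) (suc (q + d * suc c)) ++ tail d q

  staircase-tail : ∀ k → staircase (suc r) (suc c) k ≡ tail k c
  staircase-tail zero    = refl
  staircase-tail (suc k) = cong (replicate (suc r) (suc k * suc c) ++_) (staircase-tail k)

  tail-cut-0 : ∀ d q → cut 0 0 (tail d q) ≡ tail d q
  tail-cut-0 zero    q = refl
  tail-cut-0 (suc d) q =
    trans (cut-replicate-0 (suc r) _ (tail d q)) (cong (replicate (suc r) _ ++_) (tail-cut-0 d q))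

  shape-cut-0 : ∀ d p q → cut 0 0 (shape d p q) ≡ shape d p q
  shape-cut-0 d p q =
    trans (cut-replicate-0 (suc p) _ (tail d q)) (cong (replicate (suc p) _ ++_) (tail-cut-0 d q))

  tail-cut-inner : ∀ d q → cut 0 1 (tail d (suc q)) ≡ tail d q
  tail-cut-inner zero    q = refl
  tail-cut-inner (suc d) q = trans (cut-replicate-1 (suc r) _ (tail d (suc q)))
    (cong (replicate (suc r) _ ++_) (tail-cut-inner d q))

  shape-cut-inner : ∀ d p q → cut 0 1 (shape d p (suc q)) ≡ shape d p q
  shape-cut-inner d p q = trans (cut-replicate-1 (suc p) _ (tail d (suc q)))
    (cong (replicate (suc p) _ ++_) (tail-cut-inner d q))

  -- With `q` = 0 the bottom block consists of ones and vanishes. The new bottom block has its full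
  -- width again, hence `c`.
  tail-cut-outer : ∀ d → cut 0 1 (tail (suc d) 0) ≡ tail d c
  tail-cut-outer zero    = cut-ones (suc r)
  tail-cut-outer (suc d) = trans (cut-replicate-1 (suc r) _ (tail (suc d) 0))
    (cong (replicate (suc r) _ ++_) (tail-cut-outer d))

  shape-cut-outer : ∀ d p → cut 0 1 (shape (suc d) p 0) ≡ shape d p c
  shape-cut-outer d p = trans (cut-replicate-1 (suc p) _ (tail (suc d) 0))
    (cong (replicate (suc p) _ ++_) (tail-cut-outer d))

  module Rows (q : ℕ) = Countdown r (λ d p → shape d p q) drop
    (λ _ _ → refl) (λ _ _ _ → refl) (λ _ _ → refl) drop-[]

  module Columns (p : ℕ) = Countdown c (λ d q → shape d p q) (cut 0)
    (λ d q → shape-cut-0 d p q)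
    (λ a d q → trans (cut-suc a (shape d p (suc q))) (cong (cut 0 a) (shape-cut-inner d p q)))
    (λ a d → trans (cut-suc a (shape (suc d) p 0)) (cong (cut 0 a) (shape-cut-outer d p)))
    (λ a → trans (cut-suc a (shape 0 p 0)) (cong (cut 0 a) (cut-ones (suc p))))

  rectangle-shape : ∀ p q → replicate (suc p) (suc q) ≡ shape 0 p q
  rectangle-shape p q = begin
    replicate (suc p) (suc q)              ≡⟨ cong (λ x → replicate (suc p) (suc x)) (+-identityʳ q) ⟨
    replicate (suc p) (suc (q + 0))        ≡⟨ ++-identityʳ _ ⟨
    replicate (suc p) (suc (q + 0)) ++ []  ∎
    where open ≡-Reasoning

  -- Rook on staircase subpartitions.

  data RookOption : ℕ × ℕ × ℕ → ℕ × ℕ × ℕ → Set where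
    down  : ∀ {d p q d′ p′} → Below r (d′ , p′) (d , p) → RookOption (d , p , q) (d′ , p′ , q)
    right : ∀ {d p q d′ q′} → Below c (d′ , q′) (d , q) → RookOption (d , p , q) (d′ , p , q′)

  rook : Model Rook
  rook = record
    { State    = ℕ × ℕ × ℕ
    ; _⟶_     = RookOption
    ; shape    = λ (d , p , q) → shape d p q
    ; shape-≢[] = λ _ ()
    ; sound    = sound
    ; complete = complete
    }
    where
    sound : ∀ ((d , p , q) : ℕ × ℕ × ℕ) {i j} → RookMove (i , j) → cut i j (shape d p q) ≢ [] →
            ∃ λ t@(d′ , p′ , q′) → RookOption (d , p , q) t × cut i j (shape d p q) ≡ shape d′ p′ q′
    sound (d , p , q) (k0∈ {suc i} _) ne
      with d′ , p′ , b , eq ← Rows.below q i d p (λ e → ne (cong (cut 0 0) e)) =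
      (d′ , p′ , q) , down b , trans (cong (cut 0 0) eq) (shape-cut-0 d′ p′ q)
    sound (d , p , q) (0k∈ {suc j} _) ne
      with d′ , q′ , b , eq ← Columns.below p j d q ne = (d′ , p , q′) , right b , eq

    complete : ∀ {s@(d , p , q) t@(d′ , p′ , q′) : ℕ × ℕ × ℕ} → RookOption s t →
               ∃₂ λ i j → RookMove (i , j) × cut i j (shape d p q) ≡ shape d′ p′ q′
    complete {d , p , q} {d′ , p′ , _} (down b) with a , eq ← Rows.attained q d p b =
      suc a , 0 , k0∈ z<s , trans (cong (cut 0 0) eq) (shape-cut-0 d′ p′ q)
    complete {d , p , q} (right b) with a , eq ← Columns.attained p d q b =
      0 , suc a , 0k∈ z<s , eq

  Valid : Pred (ℕ × ℕ × ℕ) 0ℓ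
  Valid (d , p , q) = p ≤ r × q ≤ c

  below-valid : ∀ {n d p d′ p′} → p ≤ n → Below n (d′ , p′) (d , p) → p′ ≤ n
  below-valid p≤n (inner l)   = ≤-trans (<⇒≤ l) p≤n
  below-valid p≤n (outer _ b) = b

  valid-option : ∀ {s t} → Valid s → RookOption s t → Valid t
  valid-option (p≤r , q≤c) (down b)  = below-valid p≤r b , q≤c
  valid-option (p≤r , q≤c) (right b) = p≤r , below-valid q≤c b

  columns-valid : ∀ d p j → p ≤ r → cut 0 j (shape d p c) ≢ [] →
    ∃ λ s → Valid s × cut 0 j (shape d p c) ≡ Model.shape rook s
  columns-valid d p zero    p≤r ne = (d , p , c) , (p≤r , ≤-refl) , shape-cut-0 d p c
  columns-valid d p (suc j) p≤r ne with d′ , q′ , b , eq ← Columns.below p j d c ne =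
    (d′ , p , q′) , (p≤r , below-valid ≤-refl b) , eq

  -- Rows are removed first, with the column count still at its full value `c`, and then columns.
  -- Both countdowns respect the block bounds.
  subpartition-valid : ∀ k i j → cut i j (shape k r c) ≢ [] →
    ∃ λ s → Valid s × cut i j (shape k r c) ≡ Model.shape rook s
  subpartition-valid k zero    j ne = columns-valid k r j ≤-refl ne
  subpartition-valid k (suc i) j ne
    with d , p , b , eq ← Rows.below c i k r (λ e → ne (cong (cut 0 j) e))
    with s , v , eq′ ← columns-valid d p j (below-valid ≤-refl b)
                         (λ e → ne (trans (cong (cut 0 j) eq) e)) =
    s , v , trans (cong (cut 0 j) eq) eq′

  data RookZero : Pred (ℕ × ℕ × ℕ) 0ℓ where
    z00 : RookZero (0 , 0 , 0)
    z11 : RookZero (0 , 1 , 1)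

  data RookOne : Pred (ℕ × ℕ × ℕ) 0ℓ where
    o01 : RookOne (0 , 0 , 1)
    o10 : RookOne (0 , 1 , 0)

  -- Validity is included so that 2 ≤ p or 2 ≤ q bounds the block size from below, which guarantees
  -- room for both kinds of small position on the diagonal.
  RookOther : Pred (ℕ × ℕ × ℕ) 0ℓ
  RookOther s@(d , p , q) = Valid s × (1 ≤ d ⊎ 2 ≤ p ⊎ 2 ≤ q)

  RookLabel : Pred (ℕ × ℕ × ℕ) 0ℓ
  RookLabel s = RookZero s ⊎ RookOne s ⊎ RookOther s

  rook-label : ∀ s → Valid s → RookLabel s
  rook-label (0 , 0 , 0)           v = inj₁ z00
  rook-label (0 , 0 , 1)           v = inj₂ (inj₁ o01)
  rook-label (0 , 1 , 0)           v = inj₂ (inj₁ o10)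
  rook-label (0 , 1 , 1)           v = inj₁ z11
  rook-label (0 , 0 , suc (suc q)) v = inj₂ (inj₂ (v , inj₂ (inj₂ sz<ss)))
  rook-label (0 , 1 , suc (suc q)) v = inj₂ (inj₂ (v , inj₂ (inj₂ sz<ss)))
  rook-label (0 , suc (suc p) , q) v = inj₂ (inj₂ (v , inj₂ (inj₁ sz<ss)))
  rook-label (suc d , p , q)       v = inj₂ (inj₂ (v , inj₁ z<s))

  -- Off the diagonal, a line of moves enters the last block, which has at least two lines, and may
  -- stop at either of the last two. On the diagonal it starts beyond both.
  below-diagonal : ∀ {n d p p′} → 1 ≤ n → 1 ≤ d ⊎ 2 ≤ p → p′ ≤ 1 → Below n (0 , p′) (d , p)
  below-diagonal           1≤n (inj₁ 1≤d) p′≤1 = outer 1≤d (≤-trans p′≤1 1≤n)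
  below-diagonal {d = suc _} 1≤n (inj₂ _) p′≤1 = outer z<s (≤-trans p′≤1 1≤n)
  below-diagonal {d = zero} 1≤n (inj₂ 2≤p) p′≤1 = inner (≤-trans (s≤s p′≤1) 2≤p)

  RookBranching RookRemote : Pred (ℕ × ℕ × ℕ) 0ℓ
  RookBranching = Branching RookOption RookZero RookOne
  RookRemote    = Remote RookOption RookOther

  -- Moves to the right keep `p` and can end on the diagonal with column count 0 or 1. On these
  -- small positions the label is the parity of the sum of both counts, so one target is Zero and
  -- the other One.
  split-right : ∀ {d p q} → p ≤ 1 → 1 ≤ c → 1 ≤ d ⊎ 2 ≤ q → RookBranching (d , p , q)
  split-right z≤n       1≤c far =
    (_ , right (below-diagonal 1≤c far z≤n) , z00) , (_ , right (below-diagonal 1≤c far ≤-refl) , o01)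
  split-right (s≤s z≤n) 1≤c far =
    (_ , right (below-diagonal 1≤c far ≤-refl) , z11) , (_ , right (below-diagonal 1≤c far z≤n) , o10)

  split-down : ∀ {d p q} → q ≤ 1 → 1 ≤ r → 1 ≤ d ⊎ 2 ≤ p → RookBranching (d , p , q)
  split-down z≤n       1≤r far =
    (_ , down (below-diagonal 1≤r far z≤n) , z00) , (_ , down (below-diagonal 1≤r far ≤-refl) , o10)
  split-down (s≤s z≤n) 1≤r far =
    (_ , down (below-diagonal 1≤r far ≤-refl) , z11) , (_ , down (below-diagonal 1≤r far z≤n) , o01)

  -- A single Rook move changes only one of `p` and `q`, so the other remains at least 2.
  rook-remote : ∀ {d p q} → Valid (d , p , q) → 2 ≤ p → 2 ≤ q → RookRemote (d , p , q)
  rook-remote {d} {p} {q} v 2≤p 2≤q = (_ , down (inner (<-trans z<s 2≤p))) , other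
    where
    other : ∀ {t} → RookOption (d , p , q) t → RookOther t
    other o@(down _)  = valid-option v o , inj₂ (inj₂ 2≤q)
    other o@(right _) = valid-option v o , inj₂ (inj₁ 2≤p)

  rook-split : 1 ≤ r ⊎ 1 ≤ c → ∀ {s} → RookOther s → RookBranching s ⊎ RookRemote s
  rook-split rc {d , p , q} (v@(p≤r , q≤c) , far) with ≤-<-connex p 1 | ≤-<-connex q 1
  ... | inj₂ 2≤p | inj₂ 2≤q = inj₂ (rook-remote v 2≤p 2≤q)
  ... | inj₁ p≤1 | inj₂ 2≤q =
    inj₁ (split-right p≤1 (≤-trans (<⇒≤ 2≤q) q≤c) (inj₂ 2≤q))
  ... | inj₂ 2≤p | inj₁ q≤1 =
    inj₁ (split-down q≤1 (≤-trans (<⇒≤ 2≤p) p≤r) (inj₂ 2≤p))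
  -- Only 1 ≤ d is possible here. The move is made in the direction where `rc` grants blocks of at
  -- least two lines; unit blocks have no such direction.
  ... | inj₁ p≤1 | inj₁ q≤1 with far | rc
  ... | inj₁ 1≤d        | inj₁ 1≤r = inj₁ (split-down q≤1 1≤r (inj₁ 1≤d))
  ... | inj₁ 1≤d        | inj₂ 1≤c = inj₁ (split-right p≤1 1≤c (inj₁ 1≤d))
  ... | inj₂ (inj₁ 2≤p) | _ = contradiction (≤-trans 2≤p p≤1) λ { (s≤s ()) }
  ... | inj₂ (inj₂ 2≤q) | _ = contradiction (≤-trans 2≤q q≤1) λ { (s≤s ()) }

  rook-labelling : 1 ≤ r ⊎ 1 ≤ c → Labelling rook
  rook-labelling rc = record
    { Zero = RookZero
    ; One = RookOne
    ; Other = RookOther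
    ; zero-option = λ
      { z00 (down (inner ()))
      ; z00 (down (outer () _))
      ; z00 (right (inner ()))
      ; z00 (right (outer () _))
      ; z11 (down (inner (s≤s z≤n))) → o01
      ; z11 (down (outer () _))
      ; z11 (right (inner (s≤s z≤n))) → o10
      ; z11 (right (outer () _))
      }
    ; one-option = λ
      { o01 (down (inner ()))
      ; o01 (down (outer () _))
      ; o01 (right (inner (s≤s z≤n))) → z00
      ; o01 (right (outer () _))
      ; o10 (down (inner (s≤s z≤n))) → z00
      ; o10 (down (outer () _))
      ; o10 (right (inner ()))
      ; o10 (right (outer () _))
      }
    ; one-moves = λ
      { o01 → _ , right (inner ≤-refl)
      ; o10 → _ , down (inner ≤-refl)
      }
    ; other-option = λ (v , _) o → rook-label _ (valid-option v o)
    ; other-split = rook-split rc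
    }

-- Rook on staircases with unit blocks, a single Nim heap of size d.

module UnitBlocks where
  open Shape 0 0

  data Zero : Pred (ℕ × ℕ × ℕ) 0ℓ where
    corner : Zero (0 , 0 , 0)

  data One : Pred (ℕ × ℕ × ℕ) 0ℓ where
    next : One (1 , 0 , 0)

  data Other : Pred (ℕ × ℕ × ℕ) 0ℓ where
    far : ∀ {d} → Other (suc (suc d) , 0 , 0)

  label : ∀ s → Valid s → Zero s ⊎ One s ⊎ Other s
  label (0 , _ , _)           (z≤n , z≤n) = inj₁ corner
  label (1 , _ , _)           (z≤n , z≤n) = inj₂ (inj₁ next)
  label (suc (suc d) , _ , _) (z≤n , z≤n) = inj₂ (inj₂ far)

  labelling : Labelling rook
  labelling = record
    { Zero = Zero
    ; One = One
    ; Other = Other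
    ; zero-option = λ
      { corner (down (inner ()))
      ; corner (down (outer () _))
      ; corner (right (inner ()))
      ; corner (right (outer () _))
      }
    ; one-option = λ
      { next (down (inner ()))
      ; next (down (outer (s≤s z≤n) z≤n)) → corner
      ; next (right (inner ()))
      ; next (right (outer (s≤s z≤n) z≤n)) → corner
      }
    ; one-moves = λ { next → _ , down (outer ≤-refl z≤n) }
    ; other-option = λ { far o → label _ (valid-option (z≤n , z≤n) o) }
    ; other-split = λ { far → inj₁ ( (_ , down (outer z<s z≤n) , corner)
                                   , (_ , down (outer sz<ss z≤n) , next)) }
    }

-- King on rectangles.

module KingRectangles where
  -- The parameters are an arbitrary choice: rectangles are the shapes with d = 0, whose entries do
  -- not involve the block size.
  open Shape 0 0

  data Option : ℕ × ℕ → ℕ × ℕ → Set where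
    down     : ∀ {p q} → Option (suc p , q) (p , q)
    right    : ∀ {p q} → Option (p , suc q) (p , q)
    diagonal : ∀ {p q} → Option (suc p , suc q) (p , q)

  king : Model King
  king = record
    { State     = ℕ × ℕ
    ; _⟶_      = Option
    ; shape     = λ (p , q) → shape 0 p q
    ; shape-≢[] = λ _ ()
    ; sound     = sound
    ; complete  = complete
    }
    where
    sound : ∀ ((p , q) : ℕ × ℕ) {i j} → KingMove (i , j) → cut i j (shape 0 p q) ≢ [] →
            ∃ λ t@(p′ , q′) → Option (p , q) t × cut i j (shape 0 p q) ≡ shape 0 p′ q′
    sound (p , zero)      01∈ ne = contradiction (cut-ones (suc p)) ne
    sound (p , suc q)     01∈ ne = _ , right , shape-cut-inner 0 p q
    sound (zero , q)      10∈ ne = contradiction refl ne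
    sound (suc p , q)     10∈ ne = _ , down , shape-cut-0 0 p q
    sound (zero , q)      11∈ ne = contradiction refl ne
    sound (suc p , zero)  11∈ ne = contradiction (cut-ones (suc p)) ne
    sound (suc p , suc q) 11∈ ne = _ , diagonal , shape-cut-inner 0 p q

    complete : ∀ {s@(p , q) t@(p′ , q′) : ℕ × ℕ} → Option s t →
               ∃₂ λ i j → KingMove (i , j) × cut i j (shape 0 p q) ≡ shape 0 p′ q′
    complete (down {p} {q})     = 1 , 0 , 10∈ , shape-cut-0 0 p q
    complete (right {p} {q})    = 0 , 1 , 01∈ , shape-cut-inner 0 p q
    complete (diagonal {p} {q}) = 1 , 1 , 11∈ , shape-cut-inner 0 p q

  -- In a single row or column the King can only take one step at a time, so the label is the parity
  -- of the distance to the end, expressed here by mutual induction.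
  data Zero : Pred (ℕ × ℕ) 0ℓ
  data One  : Pred (ℕ × ℕ) 0ℓ

  data Zero where
    corner : Zero (0 , 0)
    row    : ∀ {q} → One (0 , q) → Zero (0 , suc q)
    column : ∀ {p} → One (p , 0) → Zero (suc p , 0)

  data One where
    row    : ∀ {q} → Zero (0 , q) → One (0 , suc q)
    column : ∀ {p} → Zero (p , 0) → One (suc p , 0)

  data Other : Pred (ℕ × ℕ) 0ℓ where
    body : ∀ {p q} → Other (suc p , suc q)

  row-label : ∀ q → Zero (0 , q) ⊎ One (0 , q)
  row-label zero = inj₁ corner
  row-label (suc q) with row-label q
  ... | inj₁ z = inj₂ (row z)
  ... | inj₂ o = inj₁ (row o)

  column-label : ∀ p → Zero (p , 0) ⊎ One (p , 0)
  column-label zero = inj₁ corner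
  column-label (suc p) with column-label p
  ... | inj₁ z = inj₂ (column z)
  ... | inj₂ o = inj₁ (column o)

  label : ∀ s → Zero s ⊎ One s ⊎ Other s
  label (suc p , suc q) = inj₂ (inj₂ body)
  label (zero , q) with row-label q
  ... | inj₁ z = inj₁ z
  ... | inj₂ o = inj₂ (inj₁ o)
  label (p , zero) with column-label p
  ... | inj₁ z = inj₁ z
  ... | inj₂ o = inj₂ (inj₁ o)

  -- A King move lowers each coordinate by at most one, so both stay positive.
  remote : ∀ p q → Remote Option Other (suc (suc p) , suc (suc q))
  remote p q = (_ , down) , λ { down → body ; right → body ; diagonal → body }

  -- With exactly two rows, `down` and `diagonal` lead to single rows whose lengths differ by one,
  -- hence to opposite labels; likewise `right` and `diagonal` with two columns.
  split : ∀ {s} → Other s → Branching Option Zero One s ⊎ Remote Option Other s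
  split {suc (suc p) , suc (suc q)} body = inj₂ (remote p q)
  split {suc zero , suc q} body with row-label q
  ... | inj₁ z = inj₁ ((_ , diagonal , z) , (_ , down , row z))
  ... | inj₂ o = inj₁ ((_ , down , row o) , (_ , diagonal , o))
  split {suc (suc p) , suc zero} body with column-label (suc p)
  ... | inj₁ z = inj₁ ((_ , diagonal , z) , (_ , right , column z))
  ... | inj₂ o = inj₁ ((_ , right , column o) , (_ , diagonal , o))

  labelling : Labelling king
  labelling = record
    { Zero = Zero
    ; One = One
    ; Other = Other
    ; zero-option = λ { (row o) right → o ; (column o) down → o }
    ; one-option = λ { (row z) right → z ; (column z) down → z }
    ; one-moves = λ { (row _) → _ , right ; (column _) → _ , down }
    ; other-option = λ _ _ → label _
    ; other-split = split
    }

-- The three families.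

rectangle⊆staircase : ∀ μ → Rectangle μ → StaircaseSubpartition μ
rectangle⊆staircase μ (suc r , suc c , 1≤r , 1≤c , eq) =
  -- The rectangle is a staircase with one step whose block is the rectangle itself, and nothing is
  -- cut off.
  μ , (suc r , suc c , 1 , 1≤r , 1≤c , ≤-refl , one-step) , 0 , 0 , partition-≡ (sym whole)
  where
  open Shape r c
  one-step : parts (partition μ) ≡ staircase (suc r) (suc c) 1
  one-step = trans eq (rectangle-shape r c)
  whole : cut 0 0 (parts (partition μ)) ≡ parts (partition μ)
  whole = trans (cong (cut 0 0) one-step) (trans (shape-cut-0 0 r c) (sym one-step))

rook-game : ∀ r c s {μ} → Shape.Valid r c s → Model.Depicts (Shape.rook r c) s μ →
            Forced (Rook , μ) × Miserable (Rook , μ)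
rook-game zero zero s v D = forced (label s v) D , miserable (label s v) D
  where
  open UnitBlocks
  open Labelling labelling using (forced; miserable)
rook-game r@(suc _) c s v D = forced (rook-label s v) D , miserable (rook-label s v) D
  where
  open Shape r c
  open Labelling (rook-labelling (inj₁ z<s)) using (forced; miserable)
rook-game zero c@(suc _) s v D = forced (rook-label s v) D , miserable (rook-label s v) D
  where
  open Shape 0 c
  open Labelling (rook-labelling (inj₂ z<s)) using (forced; miserable)

rook-staircase : ∀ μ → StaircaseSubpartition μ → Forced (Rook , μ) × Miserable (Rook , μ)
rook-staircase μ (σ , (suc r , suc c , suc k , _ , _ , _ , eq) , i , j , refl) =
  let s , v , D = subpartition-valid k i j (λ e → ≢[] μ (trans is-cut e))
  in rook-game r c s v (trans is-cut D)
  where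
  open Shape r c
  is-cut : cut i j (parts (partition σ)) ≡ cut i j (shape k r c)
  is-cut = cong (cut i j) (trans eq (staircase-tail (suc k)))

king-rectangle : ∀ μ → Rectangle μ → Forced (King , μ) × Miserable (King , μ)
king-rectangle μ (suc r , suc c , _ , _ , eq) = forced (label s) D , miserable (label s) D
  where
  open KingRectangles
  open Labelling labelling using (forced; miserable)
  s : ℕ × ℕ
  s = r , c
  D : Model.Depicts king s μ
  D = trans eq (Shape.rectangle-shape 0 0 r c)

-- The smallest rectangle with both counts at least 2, as `rook-remote` and `remote` demand. It
-- serves as the counterexample to being pet in all three families.
square₃ : 𝕐⁺
square₃ = mk𝕐⁺ (mkPartition (replicate 3 3) (≤-refl ∷ ≤-refl ∷ [-]) (z<s ∷ z<s ∷ z<s ∷ [])) λ ()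

square₃-rectangle : Rectangle square₃
square₃-rectangle = 3 , 3 , z<s , z<s , refl

rook-not-pet : ¬ Pet (Rook , square₃)
rook-not-pet = not-pet {0 , 2 , 2} (v , inj₂ (inj₁ ≤-refl)) (rook-remote v ≤-refl ≤-refl) refl
  where
  open Shape 2 2
  open Labelling (rook-labelling (inj₁ z<s))
  v : Valid (0 , 2 , 2)
  v = ≤-refl , ≤-refl

king-not-pet : ¬ Pet (King , square₃)
king-not-pet = not-pet {2 , 2} body (remote 0 0) refl
  where
  open KingRectangles
  open Labelling labelling using (not-pet)

theorem4p10 : ForcedMiserableNotPet Rook Rectangle ×
    ForcedMiserableNotPet King Rectangle ×
    ForcedMiserableNotPet Rook StaircaseSubpartition
theorem4p10 =
    ( (λ μ R → proj₁ (rook-staircase μ (rectangle⊆staircase μ R)))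
    , (λ μ R → proj₂ (rook-staircase μ (rectangle⊆staircase μ R)))
    , square₃ , square₃-rectangle , rook-not-pet )
  , ( (λ μ R → proj₁ (king-rectangle μ R))
    , (λ μ R → proj₂ (king-rectangle μ R))
    , square₃ , square₃-rectangle , king-not-pet )
  , ( (λ μ S → proj₁ (rook-staircase μ S))
    , (λ μ S → proj₂ (rook-staircase μ S))
    , square₃ , rectangle⊆staircase square₃ square₃-rectangle , rook-not-pet )
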